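{- For each integer $r\ge 3$ and each constant $c>0$ there exist $c'>0$ and $n_0$ such that for every $n\ge n_0$, every $K_r$-free graph on $n$ vertices with average degree at least $c\, n^{1-1/r}(\log n)^{1/(r-1)}$ contains a bipartite induced subgraph of average degree at least $c'\log n$.
   Context: All graphs are finite and simple; $\log$ is the natural logarithm; $K_r$-free means containing no complete graph on $r$ vertices as a subgraph. -}

module Defs where

open import Data.Nat as ℕ using (ℕ; zero; suc; _!)
open import Data.Nat.Properties using (_!≢0)
open import Data.Integer using (+_)
open import Data.Fin as Fin using (Fin)
open import Data.Bool using (Bool; true; false; if_then_else_; _∧_)
open import Data.Rational using (ℚ; 0ℚ; 1ℚ; _+_; _*_; _/_; _≤_)
open import Data.Product using (Σ; ∃; _×_; _,_)
open import Relation.Binary.PropositionalEquality using (_≡_; _≢_)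
open import Relation.Nullary using (¬_)
open import Function.Definitions using (Injective)

record Graph (n : ℕ) : Set where
  field
    adj    : Fin n → Fin n → Bool
    sym    : ∀ i j → adj i j ≡ adj j i
    irrefl : ∀ i → adj i i ≡ false
open Graph public

sumFin : (n : ℕ) → (Fin n → ℕ) → ℕ
sumFin zero    f = 0
sumFin (suc n) f = f Fin.zero ℕ.+ sumFin n (λ i → f (Fin.suc i))

b2n : Bool → ℕ
b2n true  = 1
b2n false = 0

size : {n : ℕ} → (Fin n → Bool) → ℕ
size {n} S = sumFin n (λ i → b2n (S i))

-- 2 · (number of edges of the induced subgraph G[S]) = sum of degrees in G[S]
degSumIn : {n : ℕ} → Graph n → (Fin n → Bool) → ℕ
degSumIn {n} G S = sumFin n (λ i → sumFin n (λ j → b2n (S i ∧ (S j ∧ adj G i j))))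

degSum : {n : ℕ} → Graph n → ℕ
degSum G = degSumIn G (λ _ → true)

-- average degree 2e/|V| (as a rational; set to 0 on the empty vertex set, never used)
avgDeg : (D s : ℕ) → ℚ
avgDeg D zero    = 0ℚ
avgDeg D (suc s) = (+ D) / suc s

ContainsK : {n : ℕ} → ℕ → Graph n → Set
ContainsK {n} r G =
  Σ (Fin r → Fin n) λ f → Injective _≡_ _≡_ f × (∀ a b → a ≢ b → adj G (f a) (f b) ≡ true)

KFree : {n : ℕ} → ℕ → Graph n → Set
KFree r G = ¬ ContainsK r G

InducedBipartite : {n : ℕ} → Graph n → (Fin n → Bool) → Set
InducedBipartite {n} G S =
  Σ (Fin n → Bool) λ col → ∀ i j → S i ≡ true → S j ≡ true → adj G i j ≡ true → col i ≢ col j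

_^ℚ_ : ℚ → ℕ → ℚ
q ^ℚ zero  = 1ℚ
q ^ℚ suc k = q * (q ^ℚ k)

expPartial : ℚ → ℕ → ℚ
expPartial q zero    = 0ℚ
expPartial q (suc k) = expPartial q k + (q ^ℚ k) * (_/_ (+ 1) (k !) {{_!≢0 k}})

-- For rational q ≥ 0:  q ≤ log n  (natural log)  ⇔  e^q ≤ n  ⇔  every partial sum of the
-- exponential series at q is ≤ n.
LeLog : ℚ → ℕ → Set
LeLog q n = ∀ k → expPartial q k ≤ ((+ n) / 1)

{-# OPTIONS --safe #-}

-- Erdős–Szekeres: a K_r-free graph on m ≥ k^(r-1) vertices has k independent vertices. Removing
-- such sets while m decreases through the scales 2^(L(r-1)) colours the graph properly with
-- t = O(n^(1-1/(r-1))) colours. Averaging over all ordered pairs of colour classes, some two classes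
-- together induce a bipartite graph of average degree at least d / 2t, where d is the average degree
-- of G. As d ≥ const · n^(1-1/r), this is at least const · n^(1/(r(r-1))), which dominates log n.
-- For the last comparison, k = r(r-1) and the k-th term of the exponential series give
-- (log n)^k ≤ k! n; in the hypothesis, log n ≥ 1/2 suffices.
module Submission where

open import Defs
open import Data.Nat using (ℕ; zero; suc; NonZero; z≤n; s≤s; >-nonZero; >-nonZero⁻¹; _!; _≥_; _∸_)
import Data.Nat as ℕ
import Data.Nat.Properties as ℕ
open import Data.Nat.Tactic.RingSolver using (solve-∀)
open import Data.Fin using (Fin)
import Data.Fin as Fin
open import Data.Fin.Properties using () renaming (_≟_ to _≟ᶠ_)
open import Data.Bool using (Bool; true; false; _∧_; _∨_)
open import Data.Product using (Σ; ∃; ∃₂; _×_; _,_)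
open import Data.Sum using (_⊎_; inj₁; inj₂)
open import Data.List using (List; []; _∷_; _++_; length; concat; lookup; allFin)
import Data.List.Properties as List
open import Data.List.Membership.Propositional using (_∈_)
open import Data.List.Membership.Propositional.Properties using (∈-++⁺ˡ; ∈-++⁺ʳ; ∈-concat⁻; ∈-allFin; ∈-lookup)
open import Data.List.Relation.Unary.Any using (Any; here; there; index)
open import Data.List.Relation.Unary.Any.Properties using (lookup-index)
open import Data.List.Relation.Unary.All as All using (All; []; _∷_)
import Data.List.Relation.Unary.All.Properties as All
open import Data.List.Relation.Unary.AllPairs using (AllPairs; []; _∷_)
open import Data.List.Relation.Binary.Subset.Propositional using (_⊆_)
open import Data.List.Relation.Binary.Permutation.Propositional using (_↭_; ↭-refl; ↭-sym; ↭-trans; ↭-prep; ↭-reflexive)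
open import Data.List.Relation.Binary.Permutation.Propositional.Properties using (↭-length; ∈-resp-↭; ++-comm; shift; ++⁺ˡ; ++⁺ʳ)
open import Relation.Nullary using (yes; no; does; contradiction)
open import Relation.Binary.PropositionalEquality using (_≡_; _≢_; refl; trans; cong; cong₂; subst; subst₂; module ≡-Reasoning)
import Relation.Binary.PropositionalEquality as ≡
open import Algebra.Bundles using (CommutativeRing)
import Algebra.Properties.CommutativeSemigroup as CommutativeSemigroupProperties
import Data.Integer as ℤ
import Data.Integer.Properties as ℤ
import Data.Rational.Properties as ℚ
open import Data.Rational.Unnormalised as ℚᵘ using (mkℚᵘ; *≡*; *≤*)
import Data.Rational.Unnormalised.Properties as ℚᵘ

-- Proper colourings of K_r-free graphs with few colours.

module Colouring where

  open import Data.Nat using (_+_; _*_; _^_; _≤_; _≤?_)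
  open import Data.Nat.Properties

  ^-distribʳ-* : ∀ k m n → (m * n) ^ k ≡ m ^ k * n ^ k
  ^-distribʳ-* zero    m n = refl
  ^-distribʳ-* (suc k) m n = begin
    m * n * (m * n) ^ k       ≡⟨ cong (m * n *_) (^-distribʳ-* k m n) ⟩
    m * n * (m ^ k * n ^ k)   ≡⟨ *-interchange m n (m ^ k) (n ^ k) ⟩
    m * m ^ k * (n * n ^ k)   ∎
    where
    open ≡-Reasoning
    open CommutativeSemigroupProperties *-commutativeSemigroup renaming (interchange to *-interchange)

  -- A power of two stands in for the `s`-th root of `n`, so that `colour` can halve its scale. When
  -- `n + 1` outgrows the current power `M`, doubling the base multiplies `M` by `2 ^ s ≥ 2`; this
  -- suffices because `M` is at least `n` and at least 1.
  root-between : ∀ s n .{{_ : NonZero s}} .{{_ : NonZero n}} →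
    ∃ λ L → n ≤ (2 ^ L) ^ s × (2 ^ L) ^ s ≤ 2 ^ s * n
  root-between s 1 = 0 , ≤-reflexive (≡.sym (^-zeroˡ s)) ,
    subst₂ _≤_ (≡.sym (^-zeroˡ s)) (≡.sym (*-identityʳ (2 ^ s))) (m^n>0 2 s)
  root-between s (suc n@(suc _)) with root-between s n
  ... | L , lo , hi with suc n ≤? (2 ^ L) ^ s
  ...   | yes le = L , le , ≤-trans hi (*-monoʳ-≤ (2 ^ s) (n≤1+n n))
  ...   | no  gt = suc L , lower , upper
    where
    open ≤-Reasoning
    M = (2 ^ L) ^ s

    lower : suc n ≤ (2 * 2 ^ L) ^ s
    lower = begin
      1 + n                ≤⟨ +-mono-≤ (m^n>0 (2 ^ L) {{m^n≢0 2 L}} s) lo ⟩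
      M + M                ≡⟨ cong (M +_) (+-identityʳ M) ⟨
      2 * M                ≤⟨ *-monoˡ-≤ M (^-monoʳ-≤ 2 (>-nonZero⁻¹ s)) ⟩
      2 ^ s * M            ≡⟨ ^-distribʳ-* s 2 (2 ^ L) ⟨
      (2 * 2 ^ L) ^ s      ∎

    upper : (2 * 2 ^ L) ^ s ≤ 2 ^ s * suc n
    upper = begin
      (2 * 2 ^ L) ^ s      ≡⟨ ^-distribʳ-* s 2 (2 ^ L) ⟩
      2 ^ s * M            ≤⟨ *-monoʳ-≤ (2 ^ s) (<⇒≤ (≰⇒> gt)) ⟩
      2 ^ s * suc n        ∎

  splitᵇ : ∀ {A : Set} (p : A → Bool) (xs : List A) →
    ∃₂ λ ys zs → All (λ x → p x ≡ true) ys × All (λ x → p x ≡ false) zs × xs ↭ ys ++ zs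
  splitᵇ p [] = [] , [] , [] , [] , ↭-refl
  splitᵇ p (x ∷ xs) with splitᵇ p xs | p x in px
  ... | ys , zs , Pys , Pzs , σ | true  = x ∷ ys , zs , px ∷ Pys , Pzs , ↭-prep x σ
  ... | ys , zs , Pys , Pzs , σ | false =
    ys , x ∷ zs , Pys , px ∷ Pzs , ↭-trans (↭-prep x σ) (↭-sym (shift x ys zs))

  -- Cliques and independent sets: the Erdős-Szekeres bound.

  module _ {n : ℕ} (G : Graph n) where

    Adj NonAdj : Fin n → Fin n → Set
    Adj    i j = adj G i j ≡ true
    NonAdj i j = adj G i j ≡ false

    record Clique (r : ℕ) (xs : List (Fin n)) : Set where
      constructor clique
      field
        vertices : List (Fin n)
        card     : length vertices ≡ r
        adjacent : AllPairs Adj vertices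
        within   : vertices ⊆ xs

    -- A clique only serves to contradict K_r-freeness, so inclusion is enough there. An independent
    -- set is to be removed, so the permutation records what is left and how many.
    record Independent (k : ℕ) (xs : List (Fin n)) : Set where
      constructor independent
      field
        chosen others : List (Fin n)
        split         : xs ↭ chosen ++ others
        card          : length chosen ≡ k
        nonadjacent   : AllPairs NonAdj chosen

    Clique-⊆ : ∀ {r xs ys} → ys ⊆ xs → Clique r ys → Clique r xs
    Clique-⊆ ys⊆xs (clique vs card adjacent within) = clique vs card adjacent (λ v∈ → ys⊆xs (within v∈))

    Independent-↭ : ∀ {k xs} ys zs → xs ↭ ys ++ zs → Independent k ys → Independent k xs
    Independent-↭ ys zs σ (independent chosen others split card nonadjacent) =
      independent chosen (others ++ zs)
        (↭-trans σ (↭-trans (++⁺ʳ zs split) (↭-reflexive (List.++-assoc chosen others zs))))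
        card nonadjacent

    -- A list of length `k * k ^ s` lets `greedy` pick `k` pairwise nonadjacent vertices at a cost
    -- of `k ^ s` each.
    ramsey : ∀ s k .{{_ : NonZero k}} xs → k ^ s ≤ length xs → Clique (suc s) xs ⊎ Independent k xs

    -- Either some vertex has at least k ^ s neighbours, and the induction on s applies to these,
    -- or discarding a vertex with its neighbours costs at most k ^ s vertices.
    greedy : ∀ s k .{{_ : NonZero k}} j xs → j * k ^ s ≤ length xs →
      Clique (suc (suc s)) xs ⊎ Independent j xs ⊎ Independent k xs

    ramsey zero    k (x ∷ xs) _ = inj₁ (clique (x ∷ []) refl ([] ∷ []) λ { (here refl) → here refl })
    ramsey (suc s) k xs h with greedy s k k xs h
    ... | inj₁ c        = inj₁ c
    ... | inj₂ (inj₁ i) = inj₂ i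
    ... | inj₂ (inj₂ i) = inj₂ i

    greedy s k zero    xs h = inj₂ (inj₁ (independent [] xs ↭-refl refl []))
    greedy s k (suc j) [] h = contradiction (≤-trans (m^n>0 k s) (≤-trans (m≤m+n _ _) h)) λ ()
    greedy s k (suc j) (x ∷ xs) h with splitᵇ (adj G x) xs
    ... | nbrs , rest , Anbrs , Arest , σ with k ^ s ≤? length nbrs
    ...   | yes big = large (ramsey s k nbrs big)
      where
      large : Clique (suc s) nbrs ⊎ Independent k nbrs →
        Clique (suc (suc s)) (x ∷ xs) ⊎ Independent (suc j) (x ∷ xs) ⊎ Independent k (x ∷ xs)
      large (inj₁ (clique vs card adjacent within)) = inj₁ (clique (x ∷ vs) (cong suc card)
        (All.anti-mono within Anbrs ∷ adjacent)
        λ { (here refl) → here refl ; (there v∈) → there (∈-resp-↭ (↭-sym σ) (∈-++⁺ˡ (within v∈))) })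
      -- An independent set among the neighbours already has the full size `k`; `x` is not added to
      -- it.
      large (inj₂ i) = inj₂ (inj₂ (Independent-↭ nbrs (x ∷ rest)
        (↭-trans (↭-prep x σ) (↭-sym (shift x nbrs rest))) i))
    ...   | no small = sparse (greedy s k j rest enough)
      where
      rest⊆ : rest ⊆ x ∷ xs
      rest⊆ v∈ = there (∈-resp-↭ (↭-sym σ) (∈-++⁺ʳ nbrs v∈))

      σ′ : xs ↭ rest ++ nbrs
      σ′ = ↭-trans σ (++-comm nbrs rest)

      -- Fewer than `k ^ s` neighbours: the strict inequality pays for `x` itself.
      enough : j * k ^ s ≤ length rest
      enough = +-cancelˡ-≤ (k ^ s) _ _ (begin
        k ^ s + j * k ^ s              ≤⟨ h ⟩
        suc (length xs)                ≡⟨ cong suc (trans (↭-length σ) (List.length-++ nbrs)) ⟩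
        suc (length nbrs) + length rest ≤⟨ +-monoˡ-≤ (length rest) (≰⇒> small) ⟩
        k ^ s + length rest            ∎)
        where open ≤-Reasoning

      sparse : Clique (suc (suc s)) rest ⊎ Independent j rest ⊎ Independent k rest →
        Clique (suc (suc s)) (x ∷ xs) ⊎ Independent (suc j) (x ∷ xs) ⊎ Independent k (x ∷ xs)
      sparse (inj₁ c) = inj₁ (Clique-⊆ rest⊆ c)
      -- The chosen vertices lie in `rest`, hence are not adjacent to `x`.
      sparse (inj₂ (inj₁ (independent chosen others split card nonadjacent))) = inj₂ (inj₁
        (Independent-cons (Independent-↭ rest nbrs σ′ (independent chosen others split card nonadjacent))
          (All.tabulate λ v∈ → All.lookup Arest (∈-resp-↭ (↭-sym split) (∈-++⁺ˡ v∈)))))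
        where
        Independent-cons : (i : Independent j xs) → All (NonAdj x) (Independent.chosen i) →
          Independent (suc j) (x ∷ xs)
        Independent-cons (independent chosen others split card nonadjacent) A =
          independent (x ∷ chosen) others (↭-prep x split) (cong suc card) (A ∷ nonadjacent)
      sparse (inj₂ (inj₂ i)) = inj₂ (inj₂ (Independent-↭ rest (x ∷ nbrs)
        (↭-trans (↭-prep x σ′) (↭-sym (shift x rest nbrs))) i))

    AllPairs-lookup : ∀ {b} vs → AllPairs (λ i j → adj G i j ≡ b) vs →
      ∀ p q → p ≢ q → adj G (lookup vs p) (lookup vs q) ≡ b
    AllPairs-lookup (v ∷ vs) (A ∷ As) Fin.zero    Fin.zero    p≢q = contradiction refl p≢q
    AllPairs-lookup (v ∷ vs) (A ∷ As) Fin.zero    (Fin.suc q) p≢q = All.lookup A (∈-lookup q)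
    AllPairs-lookup (v ∷ vs) (A ∷ As) (Fin.suc p) Fin.zero    p≢q =
      trans (sym G _ _) (All.lookup A (∈-lookup p))
    AllPairs-lookup (v ∷ vs) (A ∷ As) (Fin.suc p) (Fin.suc q) p≢q =
      AllPairs-lookup vs As p q (λ p≡q → p≢q (cong Fin.suc p≡q))

    -- The embedding sends a position to its vertex. It is injective because distinct positions
    -- carry adjacent vertices and no vertex is adjacent to itself.
    Clique⇒ContainsK : ∀ {r xs} → Clique r xs → ContainsK r G
    Clique⇒ContainsK (clique vs refl adjacent within) =
      lookup vs , (λ {p} {q} → injective p q) , AllPairs-lookup vs adjacent
      where
      injective : ∀ p q → lookup vs p ≡ lookup vs q → p ≡ q
      injective p q eq with p ≟ᶠ q
      ... | yes p≡q = p≡q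
      ... | no  p≢q = contradiction
        (trans (≡.sym (AllPairs-lookup vs adjacent p q p≢q))
          (trans (cong (adj G (lookup vs p)) (≡.sym eq)) (irrefl G (lookup vs p)))) λ ()

    AllPairs-∈ : ∀ {vs} → AllPairs NonAdj vs → ∀ {i j} → i ∈ vs → j ∈ vs → adj G i j ≡ false
    AllPairs-∈ (A ∷ As) (here refl) (here refl) = irrefl G _
    AllPairs-∈ (A ∷ As) (here refl) (there j∈)  = All.lookup A j∈
    AllPairs-∈ (A ∷ As) (there i∈)  (here refl) = trans (sym G _ _) (All.lookup A i∈)
    AllPairs-∈ (A ∷ As) (there i∈)  (there j∈)  = AllPairs-∈ As i∈ j∈

    -- Colouring by repeated removal of independent sets.

    record PartialColouring (t m : ℕ) (xs : List (Fin n)) : Set where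
      constructor colouring
      field
        classes   : List (List (Fin n))
        remaining : List (Fin n)
        split     : xs ↭ concat classes ++ remaining
        proper    : All (AllPairs NonAdj) classes
        few       : length classes ≤ t
        small     : length remaining ≤ m

    module _ {s : ℕ} (K-free : KFree (suc s) G) where

      independent-set : ∀ k .{{_ : NonZero k}} xs → k ^ s ≤ length xs → Independent k xs
      independent-set k xs h with ramsey s k xs h
      ... | inj₁ c = contradiction (Clique⇒ContainsK c) K-free
      ... | inj₂ i = i

      -- Each class takes away `k` vertices, so `t` classes use up the excess `t * k`. The process
      -- stops early once at most `k ^ s` vertices remain, where the Ramsey bound no longer applies.
      peel : ∀ k .{{_ : NonZero k}} t xs → length xs ≤ k ^ s + t * k → PartialColouring t (k ^ s) xs
      peel k zero xs h = colouring [] xs ↭-refl [] z≤n (subst (length xs ≤_) (+-identityʳ (k ^ s)) h)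
      peel k (suc t) xs h with ≤-total (length xs) (k ^ s)
      ... | inj₁ le = colouring [] xs ↭-refl [] z≤n le
      ... | inj₂ ge with independent-set k xs ge
      ...   | independent chosen others split card nonadjacent with peel k t others bound
        where
        bound : length others ≤ k ^ s + t * k
        bound = +-cancelˡ-≤ k _ _ (begin
          k + length others             ≡⟨ cong (_+ length others) card ⟨
          length chosen + length others ≡⟨ List.length-++ chosen ⟨
          length (chosen ++ others)     ≡⟨ ↭-length split ⟨
          length xs                     ≤⟨ h ⟩
          k ^ s + (k + t * k)           ≡⟨ +-assoc (k ^ s) k (t * k) ⟨
          k ^ s + k + t * k             ≡⟨ cong (_+ t * k) (+-comm (k ^ s) k) ⟩
          k + k ^ s + t * k             ≡⟨ +-assoc k (k ^ s) (t * k) ⟩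
          k + (k ^ s + t * k)           ∎)
          where open ≤-Reasoning
      ...     | colouring classes remaining split′ proper few small =
        colouring (chosen ∷ classes) remaining
          (↭-trans split (↭-trans (++⁺ˡ chosen split′)
            (↭-reflexive (≡.sym (List.++-assoc chosen (concat classes) remaining)))))
          (nonadjacent ∷ proper) (s≤s few) small

    module _ {s : ℕ} .{{_ : NonZero s}} (K-free : KFree (suc (suc s)) G) where

      -- The last stage uses 2 ^ suc s * (2 ^ L) ^ s classes of size 2 ^ L, and the numbers of classes
      -- of the successive stages grow geometrically because s ≥ 1.
      colour : ∀ L xs → length xs ≤ (2 ^ L) ^ suc s → PartialColouring (2 ^ suc s * (2 ^ L) ^ s) 0 xs
      colour zero xs h = colouring (xs ∷ []) [] (↭-reflexive (≡.sym (trans (List.++-identityʳ _) (List.++-identityʳ xs))))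
        (short xs (subst (length xs ≤_) (^-zeroˡ (suc s)) h) ∷ [])
        (*-mono-≤ (m^n>0 2 (suc s)) (m^n>0 1 s)) z≤n
        where
        short : ∀ xs → length xs ≤ 1 → AllPairs NonAdj xs
        short []       _ = []
        short (x ∷ []) _ = [] ∷ []
        short (x ∷ y ∷ xs) (s≤s ())
      colour (suc L) xs h with peel K-free (2 ^ L) {{m^n≢0 2 L}} (2 ^ suc s * (2 ^ L) ^ s) xs room
        where
        -- The permitted classes of size `2 ^ L` could cover the whole list; the summand
        -- `(2 ^ L) ^ suc s` is slack.
        room : length xs ≤ (2 ^ L) ^ suc s + 2 ^ suc s * (2 ^ L) ^ s * 2 ^ L
        room = begin
          length xs                                ≤⟨ h ⟩
          (2 * 2 ^ L) ^ suc s                      ≡⟨ ^-distribʳ-* (suc s) 2 (2 ^ L) ⟩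
          2 ^ suc s * (2 ^ L * (2 ^ L) ^ s)        ≡⟨ cong (2 ^ suc s *_) (*-comm (2 ^ L) _) ⟩
          2 ^ suc s * ((2 ^ L) ^ s * 2 ^ L)        ≡⟨ *-assoc (2 ^ suc s) _ _ ⟨
          2 ^ suc s * (2 ^ L) ^ s * 2 ^ L          ≤⟨ m≤n+m _ _ ⟩
          (2 ^ L) ^ suc s + 2 ^ suc s * (2 ^ L) ^ s * 2 ^ L ∎
          where open ≤-Reasoning
      ... | colouring classes₁ remaining₁ split₁ proper₁ few₁ small₁ with colour L remaining₁ small₁
      ...   | colouring classes₂ remaining₂ split₂ proper₂ few₂ small₂ =
        colouring (classes₁ ++ classes₂) remaining₂
          (↭-trans split₁ (↭-trans (++⁺ˡ (concat classes₁) split₂) (↭-reflexive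
            (trans (≡.sym (List.++-assoc (concat classes₁) _ _)) (cong (_++ remaining₂) (List.concat-++ classes₁ classes₂))))))
          (All.++⁺ proper₁ proper₂) count small₂
        where
        T = 2 ^ suc s * (2 ^ L) ^ s
        -- The present stage and all later ones use at most `T` classes each; doubling the scale
        -- multiplies the bound by `2 ^ s`, which absorbs `T + T`.
        count : length (classes₁ ++ classes₂) ≤ 2 ^ suc s * (2 * 2 ^ L) ^ s
        count = begin
          length (classes₁ ++ classes₂)       ≡⟨ List.length-++ classes₁ ⟩
          length classes₁ + length classes₂   ≤⟨ +-mono-≤ few₁ few₂ ⟩
          T + T                               ≡⟨ cong (T +_) (+-identityʳ T) ⟨
          2 * T                               ≤⟨ *-monoˡ-≤ T (^-monoʳ-≤ 2 (>-nonZero⁻¹ s)) ⟩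
          2 ^ s * T                           ≡⟨ *-assoc (2 ^ s) (2 ^ suc s) ((2 ^ L) ^ s) ⟨
          2 ^ s * 2 ^ suc s * (2 ^ L) ^ s     ≡⟨ cong (_* (2 ^ L) ^ s) (*-comm (2 ^ s) (2 ^ suc s)) ⟩
          2 ^ suc s * 2 ^ s * (2 ^ L) ^ s     ≡⟨ *-assoc (2 ^ suc s) (2 ^ s) ((2 ^ L) ^ s) ⟩
          2 ^ suc s * (2 ^ s * (2 ^ L) ^ s)   ≡⟨ cong (2 ^ suc s *_) (^-distribʳ-* s 2 (2 ^ L)) ⟨
          2 ^ suc s * (2 * 2 ^ L) ^ s         ∎
          where open ≤-Reasoning

      -- The constant 2 ^ (suc s * suc s + suc s * s) is (2 ^ suc s) ^ suc s * (2 ^ suc s) ^ s.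
      chromatic-bound : .{{_ : NonZero n}} → ∃ λ t →
        t ^ suc s ≤ 2 ^ (suc s * suc s + suc s * s) * n ^ s ×
        Σ (Fin n → Fin t) λ col → ∀ i j → adj G i j ≡ true → col i ≢ col j
      chromatic-bound with root-between (suc s) n
      ... | L , lo , hi with colour L (allFin n) (subst (_≤ (2 ^ L) ^ suc s) (≡.sym (List.length-tabulate {n = n} (λ i → i))) lo)
      -- At most 0 vertices remain, so the colouring is complete.
      ...   | colouring classes [] split proper few _ = length classes , bound , col , col-proper
        where
        class : ∀ i → Any (i ∈_) classes
        class i = ∈-concat⁻ classes (subst (i ∈_) (List.++-identityʳ _) (∈-resp-↭ split (∈-allFin i)))

        col : Fin n → Fin (length classes)
        col i = index (class i)

        col-proper : ∀ i j → adj G i j ≡ true → col i ≢ col j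
        col-proper i j ij eq = contradiction (trans (≡.sym ij) (AllPairs-∈
          (All.lookup proper (∈-lookup {xs = classes} (col i)))
          (lookup-index (class i)) (subst (λ a → j ∈ lookup classes a) (≡.sym eq) (lookup-index (class j))))) λ ()

        -- After raising to the power `suc s`, the scale enters through `(2 ^ L) ^ suc s`, which
        -- `root-between` bounds by `2 ^ suc s * n`.
        bound : length classes ^ suc s ≤ 2 ^ (suc s * suc s + suc s * s) * n ^ s
        bound = begin
          length classes ^ suc s                                  ≤⟨ ^-monoˡ-≤ (suc s) few ⟩
          (2 ^ suc s * (2 ^ L) ^ s) ^ suc s                       ≡⟨ ^-distribʳ-* (suc s) (2 ^ suc s) _ ⟩
          (2 ^ suc s) ^ suc s * ((2 ^ L) ^ s) ^ suc s             ≡⟨ cong₂ _*_ (^-*-assoc 2 (suc s) (suc s)) ^-swap ⟩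
          2 ^ (suc s * suc s) * ((2 ^ L) ^ suc s) ^ s             ≤⟨ *-monoʳ-≤ (2 ^ (suc s * suc s)) (^-monoˡ-≤ s hi) ⟩
          2 ^ (suc s * suc s) * (2 ^ suc s * n) ^ s               ≡⟨ cong (2 ^ (suc s * suc s) *_) (^-distribʳ-* s (2 ^ suc s) n) ⟩
          2 ^ (suc s * suc s) * ((2 ^ suc s) ^ s * n ^ s)         ≡⟨ *-assoc (2 ^ (suc s * suc s)) _ _ ⟨
          2 ^ (suc s * suc s) * (2 ^ suc s) ^ s * n ^ s           ≡⟨ cong (λ z → 2 ^ (suc s * suc s) * z * n ^ s) (^-*-assoc 2 (suc s) s) ⟩
          2 ^ (suc s * suc s) * 2 ^ (suc s * s) * n ^ s           ≡⟨ cong (_* n ^ s) (^-distribˡ-+-* 2 (suc s * suc s) (suc s * s)) ⟨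
          2 ^ (suc s * suc s + suc s * s) * n ^ s                 ∎
          where
          open ≤-Reasoning
          ^-swap : ((2 ^ L) ^ s) ^ suc s ≡ ((2 ^ L) ^ suc s) ^ s
          ^-swap = trans (^-*-assoc (2 ^ L) s (suc s)) (trans (cong ((2 ^ L) ^_) (*-comm s (suc s))) (≡.sym (^-*-assoc (2 ^ L) (suc s) s)))

-- Averaging over ordered pairs of colour classes.

module Averaging where

  open import Data.Nat using (_+_; _*_; _≤_; _<_; _≤?_; _<?_)
  open import Data.Nat.Properties

  sumFin-cong : ∀ n {f g : Fin n → ℕ} → (∀ i → f i ≡ g i) → sumFin n f ≡ sumFin n g
  sumFin-cong zero    eq = refl
  sumFin-cong (suc n) eq = cong₂ _+_ (eq Fin.zero) (sumFin-cong n (λ i → eq (Fin.suc i)))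

  sumFin-mono-≤ : ∀ n {f g : Fin n → ℕ} → (∀ i → f i ≤ g i) → sumFin n f ≤ sumFin n g
  sumFin-mono-≤ zero    le = z≤n
  sumFin-mono-≤ (suc n) le = +-mono-≤ (le Fin.zero) (sumFin-mono-≤ n (λ i → le (Fin.suc i)))

  sumFin-const : ∀ n c → sumFin n (λ _ → c) ≡ n * c
  sumFin-const zero    c = refl
  sumFin-const (suc n) c = cong (c +_) (sumFin-const n c)

  sumFin-+ : ∀ n (f g : Fin n → ℕ) → sumFin n (λ i → f i + g i) ≡ sumFin n f + sumFin n g
  sumFin-+ zero    f g = refl
  sumFin-+ (suc n) f g = trans (cong (f Fin.zero + g Fin.zero +_) (sumFin-+ n _ _))
    (+-interchange (f Fin.zero) (g Fin.zero) _ _)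
    where open CommutativeSemigroupProperties +-commutativeSemigroup renaming (interchange to +-interchange)

  sumFin-*ˡ : ∀ n c (f : Fin n → ℕ) → sumFin n (λ i → c * f i) ≡ c * sumFin n f
  sumFin-*ˡ zero    c f = ≡.sym (*-zeroʳ c)
  sumFin-*ˡ (suc n) c f = trans (cong (c * f Fin.zero +_) (sumFin-*ˡ n c _))
    (≡.sym (*-distribˡ-+ c (f Fin.zero) _))

  sumFin-*ʳ : ∀ n c (f : Fin n → ℕ) → sumFin n (λ i → f i * c) ≡ sumFin n f * c
  sumFin-*ʳ n c f = trans (sumFin-cong n (λ i → *-comm (f i) c)) (trans (sumFin-*ˡ n c f) (*-comm c _))

  sumFin-swap : ∀ m n (f : Fin m → Fin n → ℕ) →
    sumFin m (λ i → sumFin n (f i)) ≡ sumFin n (λ j → sumFin m (λ i → f i j))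
  sumFin-swap zero    n f = ≡.sym (trans (sumFin-const n 0) (*-zeroʳ n))
  sumFin-swap (suc m) n f = trans (cong (sumFin n (f Fin.zero) +_) (sumFin-swap m n _))
    (≡.sym (sumFin-+ n (f Fin.zero) _))

  sumFin-average : ∀ n {f g : Fin n → ℕ} → 0 < sumFin n f → sumFin n g ≤ sumFin n f →
    ∃ λ i → 0 < f i × g i ≤ f i
  sumFin-average (suc n) {f} {g} pos le with 0 <? f Fin.zero | g Fin.zero ≤? f Fin.zero
  ... | yes p | yes q = Fin.zero , p , q
  ... | no ¬p | _     = let i , p , q = sumFin-average n pos′ le′ in Fin.suc i , p , q
    where
    f₀≡0 : f Fin.zero ≡ 0
    f₀≡0 = n≤0⇒n≡0 (≮⇒≥ ¬p)
    pos′ : 0 < sumFin n (λ i → f (Fin.suc i))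
    pos′ = subst (λ z → 0 < z + sumFin n (λ i → f (Fin.suc i))) f₀≡0 pos
    le′ : sumFin n (λ i → g (Fin.suc i)) ≤ sumFin n (λ i → f (Fin.suc i))
    le′ = ≤-trans (m≤n+m _ (g Fin.zero)) (subst (λ z → sumFin (suc n) g ≤ z + sumFin n (λ i → f (Fin.suc i))) f₀≡0 le)
  ... | yes p | no ¬q = let i , p , q = sumFin-average n (≤-<-trans z≤n lt) (<⇒≤ lt) in Fin.suc i , p , q
    where
    lt : sumFin n (λ i → g (Fin.suc i)) < sumFin n (λ i → f (Fin.suc i))
    lt = +-cancelˡ-< (f Fin.zero) _ _ (<-≤-trans (+-monoˡ-< _ (≰⇒> ¬q)) le)

  sumFin-indicator : ∀ t (x : Fin t) → sumFin t (λ a → b2n (does (x ≟ᶠ a))) ≡ 1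
  sumFin-indicator (suc t) Fin.zero    = cong suc (trans (sumFin-const t 0) (*-zeroʳ t))
  sumFin-indicator (suc t) (Fin.suc x) = sumFin-indicator t x

  module _ {n t : ℕ} (col : Fin n → Fin t) where

    inClass : Fin t → Fin n → Bool
    inClass a i = does (col i ≟ᶠ a)

    -- After exchanging the sums, each vertex is counted once, for its own colour.
    sumFin-partition : (f : Fin n → ℕ) →
      sumFin t (λ a → sumFin n (λ i → b2n (inClass a i) * f i)) ≡ sumFin n f
    sumFin-partition f = trans (sumFin-swap t n _) (sumFin-cong n λ i →
      trans (sumFin-*ʳ t (f i) _) (trans (cong (_* f i) (sumFin-indicator t (col i))) (*-identityˡ (f i))))

    size-partition : sumFin t (λ a → size (inClass a)) ≡ n
    size-partition = begin
      sumFin t (λ a → size (inClass a))                         ≡⟨ sumFin-cong t (λ a → sumFin-cong n λ i → *-identityʳ _) ⟨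
      sumFin t (λ a → sumFin n (λ i → b2n (inClass a i) * 1))   ≡⟨ sumFin-partition (λ _ → 1) ⟩
      sumFin n (λ _ → 1)                                        ≡⟨ sumFin-const n 1 ⟩
      n * 1                                                     ≡⟨ *-identityʳ n ⟩
      n                                                         ∎
      where open ≡-Reasoning

    union : Fin t → Fin t → Fin n → Bool
    union a b i = inClass a i ∨ inClass b i

    size-union : ∀ a b → size (union a b) ≤ size (inClass a) + size (inClass b)
    size-union a b = ≤-trans (sumFin-mono-≤ n λ i → b2n-∨ (inClass a i) (inClass b i))
      (≤-reflexive (sumFin-+ n _ _))
      where
      b2n-∨ : ∀ x y → b2n (x ∨ y) ≤ b2n x + b2n y
      b2n-∨ true  y = s≤s z≤n
      b2n-∨ false y = ≤-refl

    module _ (G : Graph n) where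

      -- Each indicator stands in front of its inner sum, so that `sumFin-partition` applies once
      -- for `b` and once for `a`.
      between : Fin t → Fin t → ℕ
      between a b = sumFin n λ j → b2n (inClass b j) * sumFin n λ i → b2n (inClass a i) * b2n (adj G i j)

      between-total : sumFin t (λ a → sumFin t (between a)) ≡ degSum G
      between-total = begin
        sumFin t (λ a → sumFin t (between a))
          ≡⟨ sumFin-cong t (λ a → sumFin-partition _) ⟩
        sumFin t (λ a → sumFin n (λ j → sumFin n λ i → b2n (inClass a i) * b2n (adj G i j)))
          ≡⟨ sumFin-cong t (λ a → sumFin-swap n n _) ⟩
        sumFin t (λ a → sumFin n (λ i → sumFin n λ j → b2n (inClass a i) * b2n (adj G i j)))
          ≡⟨ sumFin-cong t (λ a → sumFin-cong n λ i → sumFin-*ˡ n (b2n (inClass a i)) _) ⟩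
        sumFin t (λ a → sumFin n (λ i → b2n (inClass a i) * sumFin n λ j → b2n (adj G i j)))
          ≡⟨ sumFin-partition _ ⟩
        degSum G ∎
        where open ≡-Reasoning

      -- Edge counts and class sizes are compared after cross-multiplication, so that the two totals
      -- coincide as natural numbers.
      between-scaled-total :
        sumFin t (λ a → sumFin t λ b → between a b * (2 * t * n)) ≡ degSum G * (2 * t * n)
      between-scaled-total = begin
        sumFin t (λ a → sumFin t λ b → between a b * (2 * t * n))
          ≡⟨ sumFin-cong t (λ a → sumFin-*ʳ t (2 * t * n) (between a)) ⟩
        sumFin t (λ a → sumFin t (between a) * (2 * t * n))
          ≡⟨ sumFin-*ʳ t (2 * t * n) (λ a → sumFin t (between a)) ⟩
        sumFin t (λ a → sumFin t (between a)) * (2 * t * n)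
          ≡⟨ cong (_* (2 * t * n)) between-total ⟩
        degSum G * (2 * t * n) ∎
        where open ≡-Reasoning

      -- Each class occurs in `t` pairs as first member and in `t` pairs as second, so the sizes add
      -- up to `t * n + t * n`.
      sizes-scaled-total :
        sumFin t (λ a → sumFin t λ b → degSum G * (size (inClass a) + size (inClass b))) ≡ degSum G * (2 * t * n)
      sizes-scaled-total = begin
        sumFin t (λ a → sumFin t λ b → D * (N a + N b))
          ≡⟨ sumFin-cong t (λ a → sumFin-*ˡ t D (λ b → N a + N b)) ⟩
        sumFin t (λ a → D * sumFin t λ b → N a + N b)
          ≡⟨ sumFin-*ˡ t D (λ a → sumFin t λ b → N a + N b) ⟩
        D * sumFin t (λ a → sumFin t λ b → N a + N b)
          ≡⟨ cong (D *_) (sumFin-cong t λ a → sumFin-+ t (λ _ → N a) N) ⟩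
        D * sumFin t (λ a → sumFin t (λ _ → N a) + sumFin t N)
          ≡⟨ cong (D *_) (sumFin-cong t λ a → cong₂ _+_ (sumFin-const t (N a)) size-partition) ⟩
        D * sumFin t (λ a → t * N a + n)
          ≡⟨ cong (D *_) (sumFin-+ t (λ a → t * N a) (λ _ → n)) ⟩
        D * (sumFin t (λ a → t * N a) + sumFin t (λ _ → n))
          ≡⟨ cong (D *_) (cong₂ _+_ (trans (sumFin-*ˡ t t N) (cong (t *_) size-partition)) (sumFin-const t n)) ⟩
        D * (t * n + t * n)
          ≡⟨ cong (D *_) (*-distribʳ-+ n t t) ⟨
        D * ((t + t) * n)
          ≡⟨ cong (λ z → D * ((t + z) * n)) (+-identityʳ t) ⟨
        D * (2 * t * n) ∎
        where
        open ≡-Reasoning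
        D = degSum G
        N : Fin t → ℕ
        N a = size (inClass a)

      -- Only edges directed from one class to the other are kept; for a proper colouring this gives
      -- away a factor of two.
      between-≤-degSumIn : ∀ a b → between a b ≤ degSumIn G (union a b)
      between-≤-degSumIn a b = sumFin-mono-≤ n λ j → ≤-trans
        (≤-reflexive (≡.sym (sumFin-*ˡ n (b2n (inClass b j)) _)))
        (sumFin-mono-≤ n λ i → ≤-trans
          (bound (inClass b j) (inClass a i) (adj G i j) (inClass a j) (inClass b i))
          (≤-reflexive (cong (λ e → b2n (union a b j ∧ (union a b i ∧ e))) (sym G i j))))
        where
        bound : ∀ bj ai ij aj bi → b2n bj * (b2n ai * b2n ij) ≤ b2n ((aj ∨ bj) ∧ ((ai ∨ bi) ∧ ij))
        bound false ai    ij    aj    bi = z≤n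
        bound true  false ij    aj    bi = z≤n
        bound true  true  false aj    bi = z≤n
        bound true  true  true  true  bi = ≤-refl
        bound true  true  true  false bi = ≤-refl

      -- Membership in class `a` is the two-colouring: vertices of the union on which it agrees lie
      -- both in `a` or both in `b`, so properness forbids an edge. This includes the case `a ≡ b`.
      union-bipartite : (∀ i j → adj G i j ≡ true → col i ≢ col j) →
        ∀ a b → InducedBipartite G (union a b)
      union-bipartite proper a b = inClass a , λ i j Si Sj ij → distinct i j Si Sj (proper i j ij)
        where
        distinct : ∀ i j → union a b i ≡ true → union a b j ≡ true → col i ≢ col j →
          inClass a i ≢ inClass a j
        distinct i j Si Sj ci≢cj with col i ≟ᶠ a | col j ≟ᶠ a | col i ≟ᶠ b | col j ≟ᶠ b
        ... | yes p | yes q | _     | _     = λ _ → ci≢cj (trans p (≡.sym q))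
        ... | yes p | no  q | _     | _     = λ ()
        ... | no  p | yes q | _     | _     = λ ()
        ... | no  p | no  q | yes u | yes v = λ _ → ci≢cj (trans u (≡.sym v))
        ... | no  p | no  q | no  u | _     = contradiction Si λ ()
        ... | no  p | no  q | yes u | no v  = contradiction Sj λ ()

  -- A crude bound, used to infer that a set with positive degree sum is nonempty.
  degSumIn-≤ : ∀ {n} (G : Graph n) S → degSumIn G S ≤ size S * n
  degSumIn-≤ {n} G S = ≤-trans (sumFin-mono-≤ n row) (≤-reflexive (sumFin-*ʳ n n (λ i → b2n (S i))))
    where
    b2n≤1 : ∀ x → b2n x ≤ 1
    b2n≤1 true  = ≤-refl
    b2n≤1 false = z≤n

    row : ∀ i → sumFin n (λ j → b2n (S i ∧ (S j ∧ adj G i j))) ≤ b2n (S i) * n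
    row i with S i
    ... | false = ≤-reflexive (trans (sumFin-const n 0) (*-zeroʳ n))
    ... | true  = ≤-trans (sumFin-mono-≤ n λ j → b2n≤1 (S j ∧ adj G i j))
      (≤-reflexive (trans (sumFin-const n 1) (*-comm n 1)))

  -- A positive degree sum gives a vertex, and the colour of that vertex shows that `t` is positive.
  2tn-positive : ∀ n t (G : Graph n) → (Fin n → Fin t) → 0 < degSum G → 0 < 2 * t * n
  2tn-positive (suc n) (suc t) G col pos = s≤s z≤n
  2tn-positive (suc n) zero    G col pos with col Fin.zero
  ... | ()

  -- Summed over all ordered pairs of colour classes, the edges between the classes give degSum G and
  -- the sizes of the classes give 2 t n, so some pair does at least as well as the average.
  dense-pair : ∀ {n t} (G : Graph n) (col : Fin n → Fin t) →
    (∀ i j → adj G i j ≡ true → col i ≢ col j) → 0 < degSum G →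
    Σ (Fin n → Bool) λ S → 0 < size S × InducedBipartite G S ×
      degSum G * size S ≤ degSumIn G S * (2 * t * n)
  dense-pair {n} {t} G col proper pos
    -- The first application selects the row `a`, the second an entry `b` of this row.
    with sumFin-average t (subst (0 <_) (≡.sym (between-scaled-total col G)) (*-mono-≤ pos (2tn-positive n t G col pos)))
           (≤-reflexive (trans (sizes-scaled-total col G) (≡.sym (between-scaled-total col G))))
  ... | a , posₐ , leₐ with sumFin-average t posₐ leₐ
  ...   | b , pos-ab , le-ab = union col a b , nonempty , union-bipartite col G proper a b , dense
    where
    open ≤-Reasoning
    S = union col a b

    nonempty : 0 < size S
    nonempty = n≢0⇒n>0 λ size≡0 → <⇒≱ pos-ab (begin
      between col G a b * (2 * t * n) ≤⟨ *-monoˡ-≤ (2 * t * n) (between-≤-degSumIn col G a b) ⟩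
      degSumIn G S * (2 * t * n)      ≤⟨ *-monoˡ-≤ (2 * t * n) (degSumIn-≤ G S) ⟩
      size S * n * (2 * t * n)        ≡⟨ cong (λ z → z * n * (2 * t * n)) size≡0 ⟩
      0                               ∎)

    dense : degSum G * size S ≤ degSumIn G S * (2 * t * n)
    dense = begin
      degSum G * size S                                           ≤⟨ *-monoʳ-≤ (degSum G) (size-union col a b) ⟩
      degSum G * (size (inClass col a) + size (inClass col b))    ≤⟨ le-ab ⟩
      between col G a b * (2 * t * n)                             ≤⟨ *-monoˡ-≤ (2 * t * n) (between-≤-degSumIn col G a b) ⟩
      degSumIn G S * (2 * t * n)                                  ∎

-- Natural numbers as rationals, powers and order.

open Colouring using (^-distribʳ-*; chromatic-bound)
open Averaging using (dense-pair)
open import Data.Integer using (+_)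
open import Data.Rational using (ℚ; 0ℚ; 1ℚ; ½; _+_; _*_; _/_; _≤_; _<_; Positive; toℚᵘ; positive; nonNegative)

module *ℚ where
  open CommutativeSemigroupProperties (CommutativeRing.*-commutativeSemigroup ℚ.+-*-commutativeRing) public

-- The form in which natural numbers are embedded in LeLog and in the theorem.
ι : ℕ → ℚ
ι n = (+ n) / 1

-- Fractions in `ℚ` are in lowest terms; identities are checked on unnormalised fractions, where
-- they are cross-multiplications.
toℚᵘ-/ : ∀ a d .{{_ : NonZero d}} → toℚᵘ ((+ a) / d) ℚᵘ.≃ ((+ a) ℚᵘ./ d)
toℚᵘ-/ a (suc d) = ℚ.toℚᵘ-fromℚᵘ (mkℚᵘ (+ a) d)

/-*-ι : ∀ a d .{{_ : NonZero d}} → ((+ a) / d) * ι d ≡ ι a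
/-*-ι a d@(suc d-1) = ℚ.toℚᵘ-injective (begin
  toℚᵘ (((+ a) / d) * ι d)            ≈⟨ ℚ.toℚᵘ-homo-* ((+ a) / d) (ι d) ⟩
  toℚᵘ ((+ a) / d) ℚᵘ.* toℚᵘ (ι d)    ≈⟨ ℚᵘ.*-cong (toℚᵘ-/ a d) (toℚᵘ-/ d 1) ⟩
  mkℚᵘ (+ a) d-1 ℚᵘ.* mkℚᵘ (+ d) 0    ≈⟨ *≡* (ℤ.*-assoc (+ a) (+ d) (+ 1)) ⟩
  mkℚᵘ (+ a) 0                        ≈⟨ toℚᵘ-/ a 1 ⟨
  toℚᵘ (ι a)                          ∎)
  where open import Relation.Binary.Reasoning.Setoid ℚᵘ.≃-setoid

ι-* : ∀ m n → ι (m ℕ.* n) ≡ ι m * ι n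
ι-* m n = ℚ.toℚᵘ-injective (begin
  toℚᵘ (ι (m ℕ.* n))                  ≈⟨ toℚᵘ-/ (m ℕ.* n) 1 ⟩
  mkℚᵘ (+ (m ℕ.* n)) 0                ≈⟨ *≡* (cong (ℤ._* (+ 1)) (ℤ.pos-* m n)) ⟩
  mkℚᵘ (+ m) 0 ℚᵘ.* mkℚᵘ (+ n) 0      ≈⟨ ℚᵘ.*-cong (toℚᵘ-/ m 1) (toℚᵘ-/ n 1) ⟨
  toℚᵘ (ι m) ℚᵘ.* toℚᵘ (ι n)          ≈⟨ ℚ.toℚᵘ-homo-* (ι m) (ι n) ⟨
  toℚᵘ (ι m * ι n)                    ∎)
  where open import Relation.Binary.Reasoning.Setoid ℚᵘ.≃-setoid

ι-mono-≤ : ∀ {m n} → m ℕ.≤ n → ι m ≤ ι n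
ι-mono-≤ {m} {n} m≤n = ℚ.toℚᵘ-cancel-≤ (begin
  toℚᵘ (ι m)   ≃⟨ toℚᵘ-/ m 1 ⟩
  mkℚᵘ (+ m) 0 ≤⟨ *≤* (ℤ.*-monoʳ-≤-nonNeg (+ 1) (ℤ.+≤+ m≤n)) ⟩
  mkℚᵘ (+ n) 0 ≃⟨ toℚᵘ-/ n 1 ⟨
  toℚᵘ (ι n)   ∎)
  where open ℚᵘ.≤-Reasoning

ι-positive : ∀ n .{{_ : NonZero n}} → Positive (ι n)
ι-positive n = ℚ.normalize-pos n 1

0≤ι : ∀ n → 0ℚ ≤ ι n
0≤ι n = ι-mono-≤ {0} {n} ℕ.z≤n

0≤/ : ∀ a d .{{_ : NonZero d}} → 0ℚ ≤ (+ a) / d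
0≤/ a d = ℚ.nonNegative⁻¹ _ {{ℚ.normalize-nonNeg a d}}

*-mono-≤ : ∀ {p q u v} → 0ℚ ≤ p → 0ℚ ≤ v → p ≤ q → u ≤ v → p * u ≤ q * v
*-mono-≤ {p} {q} {u} {v} 0≤p 0≤v p≤q u≤v = ℚ.≤-trans
  (ℚ.*-monoˡ-≤-nonNeg p {{nonNegative 0≤p}} u≤v) (ℚ.*-monoʳ-≤-nonNeg v {{nonNegative 0≤v}} p≤q)

0≤* : ∀ {p q} → 0ℚ ≤ p → 0ℚ ≤ q → 0ℚ ≤ p * q
0≤* {p} {q} 0≤p 0≤q = ℚ.nonNegative⁻¹ _ {{ℚ.nonNeg*nonNeg⇒nonNeg p {{nonNegative 0≤p}} q {{nonNegative 0≤q}}}}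

0≤^ : ∀ {p} k → 0ℚ ≤ p → 0ℚ ≤ p ^ℚ k
0≤^ zero    0≤p = ℚ.nonNegative⁻¹ 1ℚ
0≤^ (suc k) 0≤p = 0≤* 0≤p (0≤^ k 0≤p)

^-positive : ∀ p .{{_ : Positive p}} k → Positive (p ^ℚ k)
^-positive p zero    = _
^-positive p (suc k) = ℚ.pos*pos⇒pos p (p ^ℚ k) {{^-positive p k}}

^-distrib-* : ∀ k p q → (p * q) ^ℚ k ≡ p ^ℚ k * q ^ℚ k
^-distrib-* zero    p q = refl
^-distrib-* (suc k) p q = trans (cong (p * q *_) (^-distrib-* k p q)) (*ℚ.interchange p q (p ^ℚ k) (q ^ℚ k))

ι-^ : ∀ m k → ι (m ℕ.^ k) ≡ ι m ^ℚ k
ι-^ m zero    = refl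
ι-^ m (suc k) = trans (ι-* m (m ℕ.^ k)) (cong (ι m *_) (ι-^ m k))

1^ : ∀ k → 1ℚ ^ℚ k ≡ 1ℚ
1^ zero    = refl
1^ (suc k) = trans (ℚ.*-identityˡ (1ℚ ^ℚ k)) (1^ k)

^-mono-≤ : ∀ {p q} k → 0ℚ ≤ p → p ≤ q → p ^ℚ k ≤ q ^ℚ k
^-mono-≤ zero    0≤p p≤q = ℚ.≤-refl
^-mono-≤ (suc k) 0≤p p≤q = *-mono-≤ 0≤p (0≤^ k (ℚ.≤-trans 0≤p p≤q)) p≤q (^-mono-≤ k 0≤p p≤q)

^-mono-< : ∀ {p q} k → 0ℚ ≤ p → p < q → p ^ℚ suc k < q ^ℚ suc k
^-mono-< {p} {q} k 0≤p p<q = ℚ.≤-<-trans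
  (ℚ.*-monoˡ-≤-nonNeg p {{nonNegative 0≤p}} (^-mono-≤ k 0≤p (ℚ.<⇒≤ p<q)))
  (ℚ.*-monoˡ-<-pos (q ^ℚ k) {{^-positive q {{positive (ℚ.≤-<-trans 0≤p p<q)}} k}} p<q)

-- This replaces the extraction of roots: `q < p` would make the powers strictly ordered the other
-- way.
^-cancel-≤ : ∀ {p q} k → 0ℚ ≤ q → p ^ℚ suc k ≤ q ^ℚ suc k → p ≤ q
^-cancel-≤ k 0≤q le = ℚ.≮⇒≥ λ q<p → ℚ.<-irrefl refl (ℚ.<-≤-trans (^-mono-< k 0≤q q<p) le)

-- The logarithm through partial sums of the exponential series.

1/_! : ℕ → ℚ
1/ k ! = _/_ (+ 1) (k !) {{ℕ._!≢0 k}}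

0≤1/! : ∀ k → 0ℚ ≤ 1/ k !
0≤1/! k = 0≤/ 1 (k !) {{ℕ._!≢0 k}}

expPartial-nonneg : ∀ q k → 0ℚ ≤ q → 0ℚ ≤ expPartial q k
expPartial-nonneg q zero    0≤q = ℚ.≤-refl
expPartial-nonneg q (suc k) 0≤q = ℚ.+-mono-≤ (expPartial-nonneg q k 0≤q) (0≤* (0≤^ k 0≤q) (0≤1/! k))

-- All terms are nonnegative for `q ≥ 0`, so the partial sum of `suc k` terms bounds its last term,
-- the one with exponent `k`.
LeLog-power : ∀ q n k → 0ℚ ≤ q → LeLog q n → q ^ℚ k ≤ ι n * ι (k !)
LeLog-power q n k 0≤q q≤log = begin
  q ^ℚ k                                                  ≡⟨ ℚ.*-identityʳ (q ^ℚ k) ⟨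
  q ^ℚ k * 1ℚ                                             ≡⟨ cong (q ^ℚ k *_) (/-*-ι 1 (k !) {{ℕ._!≢0 k}}) ⟨
  q ^ℚ k * (1/ k ! * ι (k !))                             ≡⟨ ℚ.*-assoc (q ^ℚ k) (1/ k !) (ι (k !)) ⟨
  q ^ℚ k * 1/ k ! * ι (k !)                               ≤⟨ ℚ.*-monoʳ-≤-nonNeg (ι (k !)) {{nonNegative (0≤ι (k !))}} term ⟩
  ι n * ι (k !)                                           ∎
  where
  open ℚ.≤-Reasoning
  term : q ^ℚ k * 1/ k ! ≤ ι n
  term = begin
    q ^ℚ k * 1/ k !                       ≡⟨ ℚ.+-identityˡ (q ^ℚ k * 1/ k !) ⟨
    0ℚ + q ^ℚ k * 1/ k !                  ≤⟨ ℚ.+-monoˡ-≤ (q ^ℚ k * 1/ k !) (expPartial-nonneg q k 0≤q) ⟩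
    expPartial q (suc k)                  ≤⟨ q≤log (suc k) ⟩
    ι n                                   ∎

-- As `1/ k ! ≤ 1`, the series at 1/2 is dominated by the geometric series with sum 2.
LeLog-½ : ∀ n → 2 ℕ.≤ n → LeLog ½ n
LeLog-½ n 2≤n k = begin
  expPartial ½ k                    ≡⟨ ℚ.+-identityʳ (expPartial ½ k) ⟨
  expPartial ½ k + 0ℚ               ≤⟨ ℚ.+-monoʳ-≤ (expPartial ½ k) (0≤* (0≤ι 2) (0≤^ k (ℚ.nonNegative⁻¹ ½))) ⟩
  expPartial ½ k + ι 2 * ½ ^ℚ k     ≤⟨ geometric k ⟩
  ι 2                               ≤⟨ ι-mono-≤ 2≤n ⟩
  ι n                               ∎
  where
  open ℚ.≤-Reasoning
  1/k!≤1 : ∀ k → 1/ k ! ≤ 1ℚ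
  1/k!≤1 k = ℚ.*-cancelʳ-≤-pos (ι (k !)) {{ι-positive (k !) {{ℕ._!≢0 k}}}} (begin
    1/ k ! * ι (k !)  ≡⟨ /-*-ι 1 (k !) {{ℕ._!≢0 k}} ⟩
    ι 1               ≤⟨ ι-mono-≤ (ℕ.>-nonZero⁻¹ (k !) {{ℕ._!≢0 k}}) ⟩
    ι (k !)           ≡⟨ ℚ.*-identityˡ (ι (k !)) ⟨
    1ℚ * ι (k !)      ∎)

  -- The summand `ι 2 * ½ ^ℚ k` is the tail of the geometric series; each step moves one term from
  -- it to the partial sum.
  geometric : ∀ k → expPartial ½ k + ι 2 * ½ ^ℚ k ≤ ι 2
  geometric zero    = ℚ.≤-refl
  geometric (suc k) = begin
    expPartial ½ k + h * 1/ k ! + ι 2 * (½ * h)     ≡⟨ cong (λ z → expPartial ½ k + h * 1/ k ! + z) (≡.sym (ℚ.*-assoc (ι 2) ½ h)) ⟩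
    expPartial ½ k + h * 1/ k ! + 1ℚ * h            ≡⟨ cong (λ z → expPartial ½ k + h * 1/ k ! + z) (ℚ.*-identityˡ h) ⟩
    expPartial ½ k + h * 1/ k ! + h                 ≤⟨ ℚ.+-monoˡ-≤ h (ℚ.+-monoʳ-≤ (expPartial ½ k)
                                                         (ℚ.*-monoˡ-≤-nonNeg h {{nonNegative (0≤^ k (ℚ.nonNegative⁻¹ ½))}} (1/k!≤1 k))) ⟩
    expPartial ½ k + h * 1ℚ + h                     ≡⟨ ℚ.+-assoc (expPartial ½ k) (h * 1ℚ) h ⟩
    expPartial ½ k + (h * 1ℚ + h)                   ≡⟨ cong (λ z → expPartial ½ k + (h * 1ℚ + z)) (ℚ.*-identityʳ h) ⟨
    expPartial ½ k + (h * 1ℚ + h * 1ℚ)              ≡⟨ cong (λ z → expPartial ½ k + z) (≡.sym (ℚ.*-distribˡ-+ h 1ℚ 1ℚ)) ⟩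
    expPartial ½ k + h * ι 2                        ≡⟨ cong (λ z → expPartial ½ k + z) (ℚ.*-comm h (ι 2)) ⟩
    expPartial ½ k + ι 2 * h                        ≤⟨ geometric k ⟩
    ι 2                                             ∎
    where h = ½ ^ℚ k

-- Average degrees and the cancellation of powers of n.

avgDeg-ι : ∀ D m .{{_ : NonZero m}} → avgDeg D m * ι m ≡ ι D
avgDeg-ι D m@(suc _) = /-*-ι D m

0≤avgDeg : ∀ D m → 0ℚ ≤ avgDeg D m
0≤avgDeg D zero    = ℚ.≤-refl
0≤avgDeg D (suc m) = 0≤/ D (suc m)

-- Multiplying by both vertex counts gives the inequality of `dense-pair`, where `k` is twice the
-- number of colours.
avgDeg-≤ : ∀ {D E m n k} .{{_ : NonZero m}} .{{_ : NonZero n}} →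
  D ℕ.* m ℕ.≤ E ℕ.* (k ℕ.* n) → avgDeg D n ≤ avgDeg E m * ι k
avgDeg-≤ {D} {E} {m} {n} {k} le =
  ℚ.*-cancelʳ-≤-pos (ι n * ι m) {{ℚ.pos*pos⇒pos (ι n) {{ι-positive n}} (ι m) {{ι-positive m}}}} (begin
    avgDeg D n * (ι n * ι m)              ≡⟨ ℚ.*-assoc (avgDeg D n) (ι n) (ι m) ⟨
    avgDeg D n * ι n * ι m                ≡⟨ cong (_* ι m) (avgDeg-ι D n) ⟩
    ι D * ι m                             ≡⟨ ι-* D m ⟨
    ι (D ℕ.* m)                           ≤⟨ ι-mono-≤ le ⟩
    ι (E ℕ.* (k ℕ.* n))                   ≡⟨ trans (ι-* E (k ℕ.* n)) (cong (ι E *_) (ι-* k n)) ⟩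
    ι E * (ι k * ι n)                     ≡⟨ cong (_* (ι k * ι n)) (avgDeg-ι E m) ⟨
    avgDeg E m * ι m * (ι k * ι n)        ≡⟨ *ℚ.interchange (avgDeg E m) (ι m) (ι k) (ι n) ⟩
    avgDeg E m * ι k * (ι m * ι n)        ≡⟨ cong (avgDeg E m * ι k *_) (ℚ.*-comm (ι m) (ι n)) ⟩
    avgDeg E m * ι k * (ι n * ι m)        ∎)
  where open ℚ.≤-Reasoning

-- Supplies the positive degree sum for `dense-pair`: the density hypothesis makes a power of the
-- average degree positive.
avgDeg-positive⁻¹ : ∀ D n k .{{_ : NonZero n}} → 0ℚ < avgDeg D n ^ℚ suc k → 0 ℕ.< D
avgDeg-positive⁻¹ (suc D) n k pos = ℕ.s≤s ℕ.z≤n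
avgDeg-positive⁻¹ zero    n k pos = contradiction (begin-strict
  0ℚ                       <⟨ pos ⟩
  avgDeg 0 n ^ℚ suc k      ≤⟨ ^-mono-≤ (suc k) (0≤avgDeg 0 n) avgDeg≤0 ⟩
  0ℚ * 0ℚ ^ℚ k             ≡⟨ ℚ.*-zeroˡ (0ℚ ^ℚ k) ⟩
  0ℚ                       ∎) (ℚ.<-irrefl refl)
  where
  open ℚ.≤-Reasoning
  avgDeg≤0 : avgDeg 0 n ≤ 0ℚ
  avgDeg≤0 = ℚ.*-cancelʳ-≤-pos (ι n) {{ι-positive n}}
    (ℚ.≤-reflexive (trans (avgDeg-ι 0 n) (≡.sym (ℚ.*-zeroˡ (ι n)))))

-- At the power `K`, the colours cost `n ^ e` out of `n ^ suc e`. The surviving factor `n` means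
-- that `x` grows like the `K`-th root of `n`.
cancel-count : ∀ {C H d x K B e} t n .{{_ : NonZero n}} → 0ℚ ≤ d → 0ℚ ≤ x →
  C * ι n ^ℚ suc e * H ≤ d ^ℚ K → d ≤ x * ι t → t ℕ.^ K ℕ.≤ B ℕ.* n ℕ.^ e →
  C * ι n * H ≤ x ^ℚ K * ι B
cancel-count {C} {H} {d} {x} {K} {B} {e} t n 0≤d 0≤x hyp d≤xt t^K≤ =
  ℚ.*-cancelʳ-≤-pos (ι (n ℕ.^ e)) {{ι-positive (n ℕ.^ e) {{ℕ.m^n≢0 n e}}}} (begin
    C * ι n * H * ι (n ℕ.^ e)          ≡⟨ cong (C * ι n * H *_) (ι-^ n e) ⟩
    C * ι n * H * ι n ^ℚ e             ≡⟨ *ℚ.xy∙z≈xz∙y (C * ι n) H (ι n ^ℚ e) ⟩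
    C * ι n * ι n ^ℚ e * H             ≡⟨ cong (_* H) (ℚ.*-assoc C (ι n) (ι n ^ℚ e)) ⟩
    C * ι n ^ℚ suc e * H               ≤⟨ hyp ⟩
    d ^ℚ K                             ≤⟨ ^-mono-≤ K 0≤d d≤xt ⟩
    (x * ι t) ^ℚ K                     ≡⟨ ^-distrib-* K x (ι t) ⟩
    x ^ℚ K * ι t ^ℚ K                  ≡⟨ cong (x ^ℚ K *_) (ι-^ t K) ⟨
    x ^ℚ K * ι (t ℕ.^ K)               ≤⟨ ℚ.*-monoˡ-≤-nonNeg (x ^ℚ K) {{nonNegative (0≤^ K 0≤x)}} (ι-mono-≤ t^K≤) ⟩
    x ^ℚ K * ι (B ℕ.* n ℕ.^ e)         ≡⟨ cong (x ^ℚ K *_) (ι-* B (n ℕ.^ e)) ⟩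
    x ^ℚ K * (ι B * ι (n ℕ.^ e))       ≡⟨ ℚ.*-assoc (x ^ℚ K) (ι B) (ι (n ℕ.^ e)) ⟨
    x ^ℚ K * ι B * ι (n ℕ.^ e)         ∎)
  where open ℚ.≤-Reasoning

½^-ι : ∀ r → ½ ^ℚ r * ι (2 ℕ.^ r) ≡ 1ℚ
½^-ι r = trans (cong (½ ^ℚ r *_) (ι-^ 2 r)) (trans (≡.sym (^-distrib-* r ½ (ι 2))) (1^ r))

-- Dividing by `E` instead of its `K`-th root keeps the constant rational and is affordable because
-- `E ≤ E ^ K`.
scale-down : ∀ {c q N X} k r B F .{{_ : NonZero (B ℕ.* (2 ℕ.^ r ℕ.* F))}} → 0ℚ ≤ c → 0ℚ ≤ q →
  q ^ℚ suc k ≤ N * ι F → c ^ℚ suc k * N * ½ ^ℚ r ≤ X * ι B →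
  (c * ((+ 1) / (B ℕ.* (2 ℕ.^ r ℕ.* F))) * q) ^ℚ suc k ≤ X
scale-down {c} {q} {N} {X} k r B F 0≤c 0≤q q^K≤ hyp =
  ℚ.*-cancelʳ-≤-pos (ι E) {{ι-positive E}} (begin
    y ^ℚ K * ι E                                        ≤⟨ ℚ.*-monoˡ-≤-nonNeg (y ^ℚ K) {{nonNegative (0≤^ K 0≤y)}} (ι-mono-≤ E≤E^K) ⟩
    y ^ℚ K * ι (E ℕ.^ K)                                ≡⟨ cong (y ^ℚ K *_) (ι-^ E K) ⟩
    y ^ℚ K * ι E ^ℚ K                                   ≡⟨ ^-distrib-* K y (ι E) ⟨
    (y * ι E) ^ℚ K                                      ≡⟨ cong (_^ℚ K) y*E ⟩
    (c * q) ^ℚ K                                        ≡⟨ ^-distrib-* K c q ⟩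
    c ^ℚ K * q ^ℚ K                                     ≤⟨ ℚ.*-monoˡ-≤-nonNeg (c ^ℚ K) {{nonNegative (0≤^ K 0≤c)}} q^K≤ ⟩
    c ^ℚ K * (N * ι F)                                  ≡⟨ ℚ.*-assoc (c ^ℚ K) N (ι F) ⟨
    c ^ℚ K * N * ι F                                    ≡⟨ cong (c ^ℚ K * N *_) (ℚ.*-identityˡ (ι F)) ⟨
    c ^ℚ K * N * (1ℚ * ι F)                             ≡⟨ cong (λ z → c ^ℚ K * N * (z * ι F)) (½^-ι r) ⟨
    c ^ℚ K * N * (½ ^ℚ r * ι (2 ℕ.^ r) * ι F)           ≡⟨ cong (c ^ℚ K * N *_) (ℚ.*-assoc (½ ^ℚ r) (ι (2 ℕ.^ r)) (ι F)) ⟩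
    c ^ℚ K * N * (½ ^ℚ r * (ι (2 ℕ.^ r) * ι F))         ≡⟨ ℚ.*-assoc (c ^ℚ K * N) (½ ^ℚ r) _ ⟨
    c ^ℚ K * N * ½ ^ℚ r * (ι (2 ℕ.^ r) * ι F)           ≡⟨ cong (c ^ℚ K * N * ½ ^ℚ r *_) (ι-* (2 ℕ.^ r) F) ⟨
    c ^ℚ K * N * ½ ^ℚ r * ι (2 ℕ.^ r ℕ.* F)             ≤⟨ ℚ.*-monoʳ-≤-nonNeg (ι (2 ℕ.^ r ℕ.* F)) {{nonNegative (0≤ι (2 ℕ.^ r ℕ.* F))}} hyp ⟩
    X * ι B * ι (2 ℕ.^ r ℕ.* F)                         ≡⟨ ℚ.*-assoc X (ι B) (ι (2 ℕ.^ r ℕ.* F)) ⟩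
    X * (ι B * ι (2 ℕ.^ r ℕ.* F))                       ≡⟨ cong (X *_) (ι-* B (2 ℕ.^ r ℕ.* F)) ⟨
    X * ι E                                             ∎)
  where
  open ℚ.≤-Reasoning
  K = suc k
  E = B ℕ.* (2 ℕ.^ r ℕ.* F)
  y = c * ((+ 1) / E) * q

  0≤y : 0ℚ ≤ y
  0≤y = 0≤* (0≤* 0≤c (0≤/ 1 E)) 0≤q

  E≤E^K : E ℕ.≤ E ℕ.^ K
  E≤E^K = ℕ.m≤m*n E (E ℕ.^ k) {{ℕ.m^n≢0 E k}}

  y*E : y * ι E ≡ c * q
  y*E = begin-equality
    c * ((+ 1) / E) * q * ι E       ≡⟨ *ℚ.xy∙z≈xz∙y (c * ((+ 1) / E)) q (ι E) ⟩
    c * ((+ 1) / E) * ι E * q       ≡⟨ cong (_* q) (ℚ.*-assoc c ((+ 1) / E) (ι E)) ⟩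
    c * (((+ 1) / E) * ι E) * q     ≡⟨ cong (λ z → c * z * q) (/-*-ι 1 E) ⟩
    c * 1ℚ * q                      ≡⟨ cong (_* q) (ℚ.*-identityʳ c) ⟩
    c * q                           ∎

-- The exponent `r * (r - 1)` clears the roots in the number of colours and in the density
-- hypothesis simultaneously.
colours-power : ∀ s t n A → t ℕ.^ suc s ℕ.≤ A ℕ.* n ℕ.^ s →
  (2 ℕ.* t) ℕ.^ (suc (suc s) ℕ.* suc s) ℕ.≤
    2 ℕ.^ (suc (suc s) ℕ.* suc s) ℕ.* A ℕ.^ suc (suc s) ℕ.* n ℕ.^ (s ℕ.* suc (suc s))
colours-power s t n A le = begin
  (2 ℕ.* t) ℕ.^ K                                     ≡⟨ ^-distribʳ-* K 2 t ⟩
  2 ℕ.^ K ℕ.* t ℕ.^ K                                 ≡⟨ cong (λ e → 2 ℕ.^ K ℕ.* t ℕ.^ e) (ℕ.*-comm r (suc s)) ⟩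
  2 ℕ.^ K ℕ.* t ℕ.^ (suc s ℕ.* r)                     ≡⟨ cong (2 ℕ.^ K ℕ.*_) (ℕ.^-*-assoc t (suc s) r) ⟨
  2 ℕ.^ K ℕ.* (t ℕ.^ suc s) ℕ.^ r                     ≤⟨ ℕ.*-monoʳ-≤ (2 ℕ.^ K) (ℕ.^-monoˡ-≤ r le) ⟩
  2 ℕ.^ K ℕ.* (A ℕ.* n ℕ.^ s) ℕ.^ r                   ≡⟨ cong (2 ℕ.^ K ℕ.*_) (^-distribʳ-* r A (n ℕ.^ s)) ⟩
  2 ℕ.^ K ℕ.* (A ℕ.^ r ℕ.* (n ℕ.^ s) ℕ.^ r)           ≡⟨ cong (λ z → 2 ℕ.^ K ℕ.* (A ℕ.^ r ℕ.* z)) (ℕ.^-*-assoc n s r) ⟩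
  2 ℕ.^ K ℕ.* (A ℕ.^ r ℕ.* n ℕ.^ (s ℕ.* r))           ≡⟨ ℕ.*-assoc (2 ℕ.^ K) (A ℕ.^ r) _ ⟨
  2 ℕ.^ K ℕ.* A ℕ.^ r ℕ.* n ℕ.^ (s ℕ.* r)             ∎
  where
  open ℕ.≤-Reasoning
  r = suc (suc s)
  K = r ℕ.* suc s

-- Assembly of colouring, averaging and logarithmic comparison.

theorem3p11 : (r : ℕ) → r ≥ 3 → (c : ℚ) → 0ℚ < c →
    Σ ℚ λ c′ → 0ℚ < c′ × Σ ℕ λ n₀ →
    (n : ℕ) → n ≥ n₀ → n ≥ 1 → (G : Graph n) → KFree r G →
    (∀ q → 0ℚ ≤ q → LeLog q n →
    (c ^ℚ (r Data.Nat.* (r ∸ 1))) * (((+ n) / 1) ^ℚ ((r ∸ 1) Data.Nat.* (r ∸ 1))) * (q ^ℚ r)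
    ≤ avgDeg (degSum G) n ^ℚ (r Data.Nat.* (r ∸ 1))) →
    Σ (Fin n → Bool) λ S → size S ≥ 1 × InducedBipartite G S ×
    (∀ q → 0ℚ ≤ q → LeLog q n → c′ * q ≤ avgDeg (degSumIn G S) (size S))
theorem3p11 (suc (suc (suc s-1))) (s≤s (s≤s (s≤s z≤n))) c 0<c =
  -- The threshold 2 is the one of `LeLog-½`.
  c * ((+ 1) / E) , ℚ.positive⁻¹ _ {{ℚ.pos*pos⇒pos c ((+ 1) / E) {{ℚ.normalize-pos 1 E}}}} , 2 , main
  where
  -- `s = r - 2` is at least 1, as the geometric growth in `colour` requires.
  s = suc s-1
  r = suc (suc s)
  K = r ℕ.* suc s
  -- `A` comes from `chromatic-bound` and `B` from `colours-power`; in `E`, the factor `2 ^ r`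
  -- offsets `½ ^ℚ r` and `K !` the denominator of the exponential term.
  A = 2 ℕ.^ (suc s ℕ.* suc s ℕ.+ suc s ℕ.* s)
  B = 2 ℕ.^ K ℕ.* A ℕ.^ r
  E = B ℕ.* (2 ℕ.^ r ℕ.* K !)

  instance
    c-positive : Positive c
    c-positive = positive 0<c

    E≢0 : NonZero E
    E≢0 = ℕ.m*n≢0 B (2 ℕ.^ r ℕ.* K !)
      {{ℕ.m*n≢0 (2 ℕ.^ K) (A ℕ.^ r) {{ℕ.m^n≢0 2 K}} {{ℕ.m^n≢0 A r {{ℕ.m^n≢0 2 (suc s ℕ.* suc s ℕ.+ suc s ℕ.* s)}}}}}}
      {{ℕ.m*n≢0 (2 ℕ.^ r) (K !) {{ℕ.m^n≢0 2 r}} {{ℕ._!≢0 K}}}}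

  -- The exponent of `n` in the hypothesis exceeds that in `colours-power` by exactly one.
  square : ∀ s → suc s ℕ.* suc s ≡ suc (s ℕ.* suc (suc s))
  square = solve-∀

  main : (n : ℕ) → n ≥ 2 → n ≥ 1 → (G : Graph n) → KFree r G →
    (∀ q → 0ℚ ≤ q → LeLog q n →
      c ^ℚ K * ι n ^ℚ (suc s ℕ.* suc s) * q ^ℚ r ≤ avgDeg (degSum G) n ^ℚ K) →
    Σ (Fin n → Bool) λ S → size S ≥ 1 × InducedBipartite G S ×
      (∀ q → 0ℚ ≤ q → LeLog q n → c * ((+ 1) / E) * q ≤ avgDeg (degSumIn G S) (size S))
  main n n≥2 n≥1 G K-free dense =
    let t , t-bound , col , proper = chromatic-bound G {s} K-free
        S , nonempty , bipartite , ratio = dense-pair G col proper D>0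
        X = avgDeg (degSumIn G S) (size S)
        average : c ^ℚ K * ι n * ½ ^ℚ r ≤ X ^ℚ K * ι B
        average = cancel-count {C = c ^ℚ K} {H = ½ ^ℚ r} {d = avgDeg (degSum G) n} {x = X} {K = K} {B = B} {e = s ℕ.* suc (suc s)} (2 ℕ.* t) n (0≤avgDeg (degSum G) n) (0≤avgDeg (degSumIn G S) (size S))
          hyp½ (avgDeg-≤ {D = degSum G} {E = degSumIn G S} {m = size S} {k = 2 ℕ.* t} {{>-nonZero nonempty}} ratio) (colours-power s t n A t-bound)
    in S , nonempty , bipartite , λ q 0≤q q≤log →
      -- `K` is the successor of `s + suc s * suc s`, the form in which powers are cancelled.
      ^-cancel-≤ {p = c * ((+ 1) / E) * q} {q = X} (s ℕ.+ suc s ℕ.* suc s) (0≤avgDeg (degSumIn G S) (size S))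
        (scale-down {c = c} {q = q} {N = ι n} {X = X ^ℚ K} (s ℕ.+ suc s ℕ.* suc s) r B (K !) (ℚ.<⇒≤ 0<c) 0≤q (LeLog-power q n K 0≤q q≤log) average)
    where
    instance
      n≢0 : NonZero n
      n≢0 = >-nonZero n≥1

    hyp½ : c ^ℚ K * ι n ^ℚ suc (s ℕ.* suc (suc s)) * ½ ^ℚ r ≤ avgDeg (degSum G) n ^ℚ K
    hyp½ = subst (λ e → c ^ℚ K * ι n ^ℚ e * ½ ^ℚ r ≤ avgDeg (degSum G) n ^ℚ K) (square s)
      (dense ½ (ℚ.nonNegative⁻¹ ½) (LeLog-½ n n≥2))

    D>0 : 0 ℕ.< degSum G
    D>0 = avgDeg-positive⁻¹ (degSum G) n (s ℕ.+ suc s ℕ.* suc s)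
      (ℚ.<-≤-trans (ℚ.positive⁻¹ _ {{positive-lhs}}) hyp½)
      where
      e = suc (s ℕ.* suc (suc s))
      positive-lhs : Positive (c ^ℚ K * ι n ^ℚ e * ½ ^ℚ r)
      positive-lhs = ℚ.pos*pos⇒pos (c ^ℚ K * ι n ^ℚ e)
        {{ℚ.pos*pos⇒pos (c ^ℚ K) {{^-positive c K}} (ι n ^ℚ e) {{^-positive (ι n) {{ι-positive n}} e}}}}
        (½ ^ℚ r) {{^-positive ½ r}}
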